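{- Let $p$ be a prime with $p \equiv 1 \pmod 3$, let $\alpha \ge 1$ and $q = p^{\alpha}$. Let $L, M$ be integers satisfying $$4q = L^2 + 27M^2, \qquad L \equiv 1 \pmod 3, \qquad p \nmid L.$$ Then the $1\times 2$ matrix $$\left[\ \frac{L+3M}{2},\ \ \frac{L-3M}{2}\ \right]$$ whose integer entries are reduced modulo $p$ and regarded as elements of $\mathbb F_p \subseteq \mathbb F_q$, is a generator matrix of a $[2,1,2]$ MDS code over $\mathbb F_q$.
   Context: An $[n,k,d]$-code over $\mathbb F_q$ is a linear subspace of $\mathbb F_q^n$ of dimension $k$ and minimum (Hamming) distance $d$. It is called MDS (maximum distance separable) if $n+1 = k+d$. A generator matrix of a linear code is a matrix whose rows form a basis of the code. The equation $4q=L^2+27M^2$ forces $L\equiv M \pmod 2$, so $\frac{L\pm 3M}{2}$ are integers. -}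

module Defs where

open import Algebra.Apartness.Bundles using (HeytingField; HeytingCommutativeRing)
open import Algebra.Bundles using (CommutativeRing)
open import Data.Fin.Base using (Fin)
open import Data.Integer.Base using (ℤ; _%ℕ_)
open import Data.List.Base using (length; filter; allFin)
open import Data.Nat.Base using (ℕ; _+_; _≤_)
open import Data.Nat.Primality using (Prime; prime⇒nonZero)
open import Data.Product.Base using (∃; ∃₂; _×_)
open import Data.Vec.Functional using (Vector; zipWith; map; replicate)
open import Function.Bundles using (Inverse)
open import Function.Properties.Inverse using (Inverse⇒Injection)
open import Level using (Level; _⊔_; suc)
open import Relation.Binary.Definitions using (Decidable)
import Relation.Binary.PropositionalEquality as ≡
open import Relation.Nullary.Decidable using (¬?; via-injection)
open import Relation.Nullary.Negation using (¬_)
open import Relation.Unary using (Pred; _∈_)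
import Algebra.Definitions.RawMonoid as RawMonoidDefs
import Data.Fin.Properties as Fin
import Data.Vec.Functional.Relation.Binary.Equality.Setoid as VecEq

-- In the presence of the enumeration, _≈_ is decidable; as the apartness of a
-- Heyting field is tight and amounts to invertibility of the difference, every
-- x with ¬ (x ≈ 0#) is then invertible, so this is a field in the usual sense.
record FiniteField c ℓ₁ ℓ₂ (q : ℕ) : Set (suc (c ⊔ ℓ₁ ⊔ ℓ₂)) where
  field
    heytingField : HeytingField c ℓ₁ ℓ₂

  commutativeRing : CommutativeRing c ℓ₁
  commutativeRing = HeytingCommutativeRing.commutativeRing
    (HeytingField.heytingCommutativeRing heytingField)

  open CommutativeRing commutativeRing using (Carrier; _≈_; setoid)

  field
    enumeration : Inverse setoid (≡.setoid (Fin q))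

  infix 4 _≟_
  _≟_ : Decidable _≈_
  _≟_ = via-injection (Inverse⇒Injection enumeration) Fin._≟_

module Codes {c ℓ₁ ℓ₂ : Level} {q : ℕ} (F : FiniteField c ℓ₁ ℓ₂ q) where

  open FiniteField F using (commutativeRing; _≟_)
  open CommutativeRing commutativeRing
    using (Carrier; setoid; 0#; 1#; +-rawMonoid)
    renaming (_+_ to _+F_; _*_ to _*F_)
  open RawMonoidDefs +-rawMonoid using (sum) renaming (_×_ to _·_)
  open VecEq setoid using (_≋_)

  -- The residue of x in {0, …, p - 1}, as an element of the prime subfield
  -- {r · 1#} of F.  This is 𝔽_p ⊆ F when q is a power of p.
  reduceMod : ∀ {p} → Prime p → ℤ → Carrier
  reduceMod {p} pr x = (x %ℕ p) · 1#
    where instance _ = prime⇒nonZero pr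

  Word : ℕ → Set c
  Word n = Vector Carrier n

  Matrix : ℕ → ℕ → Set c
  Matrix k n = Vector (Word n) k

  record LinearCode (n : ℕ) : Set (suc (c ⊔ ℓ₁)) where
    field
      codewords : Pred (Word n) (c ⊔ ℓ₁)
      resp-≋    : ∀ {x y} → x ≋ y → x ∈ codewords → y ∈ codewords
      0-closed  : replicate n 0# ∈ codewords
      +-closed  : ∀ {x y} → x ∈ codewords → y ∈ codewords →
                  zipWith _+F_ x y ∈ codewords
      *-closed  : ∀ a {x} → x ∈ codewords → map (a *F_) x ∈ codewords

  open LinearCode public

  linComb : ∀ {k n} → Vector Carrier k → Matrix k n → Word n
  linComb a v j = sum (λ i → a i *F v i j)

  record IsBasis {k n : ℕ} (C : LinearCode n) (v : Matrix k n) :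
                 Set (c ⊔ ℓ₁) where
    field
      members     : ∀ i → v i ∈ codewords C
      independent : ∀ a → linComb a v ≋ replicate n 0# → a ≋ replicate k 0#
      spanning    : ∀ {x} → x ∈ codewords C → ∃ λ a → linComb a v ≋ x

  HasDimension : ∀ {n} → LinearCode n → ℕ → Set (c ⊔ ℓ₁)
  HasDimension {n} C k = ∃ λ (v : Matrix k n) → IsBasis C v

  hammingDistance : ∀ {n} → Word n → Word n → ℕ
  hammingDistance {n} x y = length (filter (λ i → ¬? (x i ≟ y i)) (allFin n))

  record HasMinimumDistance {n : ℕ} (C : LinearCode n) (d : ℕ) :
                            Set (c ⊔ ℓ₁) where
    field
      attained : ∃₂ λ x y → x ∈ codewords C × y ∈ codewords C ×
                   ¬ (x ≋ y) × hammingDistance x y ≡.≡ d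
      minimal  : ∀ {x y} → x ∈ codewords C → y ∈ codewords C →
                   ¬ (x ≋ y) → d ≤ hammingDistance x y

  record Is[_,_,_]Code (n k d : ℕ) (C : LinearCode n) : Set (c ⊔ ℓ₁) where
    field
      dimension       : HasDimension C k
      minimumDistance : HasMinimumDistance C d

  record Is[_,_,_]MDSCode (n k d : ℕ) (C : LinearCode n) : Set (c ⊔ ℓ₁) where
    field
      isCode : Is[ n , k , d ]Code C
      mds    : n + 1 ≡.≡ k + d

  IsGeneratorMatrix : ∀ {k n} → Matrix k n → LinearCode n → Set (c ⊔ ℓ₁)
  IsGeneratorMatrix G C = IsBasis C G

-- Put H = (L ± 3M)/2.  The hypothesis 4q = L² + 27M² becomes L² = q + 3H(L − H),
-- so p ∣ H would give p ∣ L.  Hence both entries are prime to p, and since q · x = 0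
-- for every x in a field with q elements, Bézout shows that they can be cancelled.
-- Two distinct multiples of the row therefore differ in both coordinates.
module Submission where

open import Defs
open import Algebra.Apartness.Bundles using (HeytingField)
open import Algebra.Bundles using (AbelianGroup; CommutativeRing; Monoid)
open import Data.Fin as Fin using (Fin)
open import Data.Fin.Permutation using (Permutation; permutation)
open import Data.Integer using (ℤ; +_; _+_; _-_; _*_; _^_; _/_; _%_; _/ℕ_; _%ℕ_; ∣_∣)
open import Data.Integer.Divisibility using (_∣_)
open import Data.Integer.DivMod using (a≡a%n+[a/n]*n; a≡a%ℕn+[a/ℕn]*n; n%d<d; n%ℕd<d)
open import Data.Integer.Properties using (+-identityˡ; abs-*; *-cancelˡ-≡)
open import Data.Integer.Tactic.RingSolver using (solve-∀)
open import Data.List using (allFin; length)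
open import Data.List.Properties using (filter-all; length-tabulate)
open import Data.List.Relation.Unary.All using (universal)
open import Data.Nat as ℕ using (ℕ; zero; suc)
open import Data.Nat.Coprimality as Coprime using (Coprime; coprime-Bézout; coprime-divisor; prime⇒coprime)
open import Data.Nat.GCD using (module Bézout)
open import Data.Nat.Primality using (Prime; euclidsLemma; prime⇒nonZero)
open import Data.Product using (∃; _×_; _,_)
open import Data.Sum using (reduce)
open import Data.Vec.Functional using (_∷_; []; replicate)
open import Function using (_∘_; Inverse)
open import Level using (Level)
open import Relation.Binary.PropositionalEquality as ≡ using (_≡_)
open import Relation.Nullary using (¬_; ¬?; contradiction)
import Algebra.Properties.AbelianGroup as AbelianGroupProperties
import Algebra.Properties.CommutativeMonoid.Sum as Sum
import Algebra.Properties.Monoid.Mult as Mult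
import Algebra.Properties.Ring as RingProperties
import Algebra.Properties.Semiring.Mult as SemiringMult
import Data.Integer.Divisibility.Signed as Signed
import Data.Nat.Divisibility as ℕ
import Data.Nat.Properties as ℕ
import Relation.Binary.Reasoning.Setoid as SetoidReasoning

-- Divisibility by p, and the integers (L ± 3M)/2.

coprime-^ʳ : ∀ {m n} → Coprime m n → ∀ k → Coprime m (n ℕ.^ k)
coprime-^ʳ c zero    (_ , d∣1) = ℕ.∣1⇒≡1 d∣1
-- A common divisor d is coprime to n, since it divides m; so it can be pushed past the factor n,
-- down to `n ^ k`.
coprime-^ʳ c (suc k) (d∣m , d∣n*n^k) = coprime-^ʳ c k
  (d∣m , coprime-divisor (λ (e∣d , e∣n) → c (ℕ.∣-trans e∣d d∣m , e∣n)) d∣n*n^k)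

module _ {p} (p-prime : Prime p) where

  private instance
    _ = prime⇒nonZero p-prime

  prime∣square⇒prime∣ : ∀ x → + p ∣ x * x → + p ∣ x
  prime∣square⇒prime∣ x p∣x² =
    reduce (euclidsLemma ∣ x ∣ ∣ x ∣ p-prime (≡.subst (p ℕ.∣_) (abs-* x x) p∣x²))

  -- A nonzero residue is smaller than the prime p, hence coprime to it; a zero residue would make x
  -- the multiple `(x /ℕ p) * + p`.
  prime∤⇒coprime-% : ∀ {x} → ¬ + p ∣ x → Coprime (x %ℕ p) p
  prime∤⇒coprime-% {x} p∤x =
    Coprime.sym (prime⇒coprime p-prime {{ℕ.≢-nonZero r≢0}} (n%ℕd<d x p))
    where
    r≢0 : ¬ (x %ℕ p) ≡ 0
    r≢0 r≡0 = p∤x (Signed.∣⇒∣ᵤ {+ p} (Signed.divides (x /ℕ p)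
      (≡.trans (a≡a%ℕn+[a/ℕn]*n x p)
        (≡.trans (≡.cong (λ r → + r + (x /ℕ p) * + p) r≡0) (+-identityˡ _)))))

-- Stated for S = L ± 3M; M has been eliminated, so that one lemma covers both signs.
square-via-half : ∀ q L S → + 4 * q + + 6 * (S * L) ≡ + 4 * (L * L) + + 3 * (S * S) →
  L * L ≡ q + + 3 * (L - S / + 2) * (S / + 2)
square-via-half q L S eq = go (S / + 2) (S % + 2) (n%d<d S (+ 2)) (a≡a%n+[a/n]*n S (+ 2))
  where
  open ≡.≡-Reasoning

  go : ∀ H r → r ℕ.< 2 → S ≡ + r + H * + 2 → L * L ≡ q + + 3 * (L - H) * H
  -- For S = 2H, once 3S² is subtracted every term of `eq` is a multiple of 4.
  go H 0 _ ≡.refl = *-cancelˡ-≡ (+ 4) _ _ (begin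
    + 4 * (L * L)                                ≡⟨ lhs (+ 4 * (L * L)) S ⟩
    + 4 * (L * L) + + 3 * (S * S) - + 3 * (S * S) ≡⟨ ≡.cong (_- + 3 * (S * S)) eq ⟨
    + 4 * q + + 6 * (S * L) - + 3 * (S * S)       ≡⟨ rhs q L H ⟩
    + 4 * (q + + 3 * (L - H) * H)                ∎)
    where
    lhs : ∀ a s → a ≡ a + + 3 * (s * s) - + 3 * (s * s)
    lhs = solve-∀
    rhs : ∀ q L H → + 4 * q + + 6 * ((+ 0 + H * + 2) * L) - + 3 * ((+ 0 + H * + 2) * (+ 0 + H * + 2))
      ≡ + 4 * (q + + 3 * (L - H) * H)
    rhs = solve-∀
  -- Modulo 2 the hypothesis reads 0 = S².
  go H 1 _ ≡.refl = contradiction (ℕ.∣1⇒≡1 (Signed.∣⇒∣ᵤ (Signed.divides X (begin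
    + 1                                                         ≡⟨ lhs L H ⟩
    + 4 * (L * L) + + 3 * (S * S) - + 2 * Y                      ≡⟨ ≡.cong (_- + 2 * Y) eq ⟨
    + 4 * q + + 6 * (S * L) - + 2 * Y                            ≡⟨ rhs q L H ⟩
    X * + 2                                                     ∎)))) λ ()
    where
    -- For odd S = 1 + 2H the right side of `eq` is 1 + 2Y, while the left side is even; the
    -- difference gives 1 = 2X.
    Y = + 2 * (L * L) + + 6 * (H * H) + + 6 * H + + 1
    X = + 2 * q + + 3 * ((+ 1 + H * + 2) * L) - Y
    lhs : ∀ L H → + 1 ≡ + 4 * (L * L) + + 3 * ((+ 1 + H * + 2) * (+ 1 + H * + 2))
      - + 2 * (+ 2 * (L * L) + + 6 * (H * H) + + 6 * H + + 1)
    lhs = solve-∀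
    rhs : ∀ q L H → + 4 * q + + 6 * ((+ 1 + H * + 2) * L)
        - + 2 * (+ 2 * (L * L) + + 6 * (H * H) + + 6 * H + + 1)
      ≡ (+ 2 * q + + 3 * ((+ 1 + H * + 2) * L)
        - (+ 2 * (L * L) + + 6 * (H * H) + + 6 * H + + 1)) * + 2
    rhs = solve-∀
  go H (suc (suc _)) (ℕ.s≤s (ℕ.s≤s ()))

-- With H = S / 2, `square-via-half` reads L² = 3(L - H)H modulo p, so p ∣ H forces p ∣ L² and then
-- p ∣ L.
prime∤half : ∀ {p} → Prime p → ∀ q L S → + 4 * q + + 6 * (S * L) ≡ + 4 * (L * L) + + 3 * (S * S) →
  + p ∣ q → ¬ + p ∣ L → ¬ + p ∣ S / + 2
prime∤half {p} p-prime q L S eq p∣q p∤L p∣H = p∤L (prime∣square⇒prime∣ p-prime L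
  (Signed.∣⇒∣ᵤ (≡.subst (+ p Signed.∣_) (≡.sym (square-via-half q L S eq))
    (Signed.∣m∣n⇒∣m+n (Signed.∣ᵤ⇒∣ {i = q} p∣q)
      (Signed.∣n⇒∣m*n (+ 3 * (L - S / + 2)) (Signed.∣ᵤ⇒∣ {i = S / + 2} p∣H))))))

-- Vanishing multiples in monoids and finite abelian groups.

module _ {c ℓ} (M : Monoid c ℓ) where
  open Monoid M
  open Mult M using () renaming (_×_ to _·_; ×-homo-+ to ·-homo-+; ×-assocˡ to ·-assocˡ; ×-congʳ to ·-congʳ)
  open SetoidReasoning setoid

  private
    ·-ε : ∀ n → n · ε ≈ ε
    ·-ε zero    = refl
    ·-ε (suc n) = trans (identityˡ _) (·-ε n)

    multiple-vanishes : ∀ k {n x} → n · x ≈ ε → (k ℕ.* n) · x ≈ ε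
    multiple-vanishes k {n} {x} nx≈ε = begin
      (k ℕ.* n) · x ≈⟨ ·-assocˡ x k n ⟨
      k · (n · x)   ≈⟨ ·-congʳ k nx≈ε ⟩
      k · ε         ≈⟨ ·-ε k ⟩
      ε             ∎

    successive-vanish : ∀ {m n x} → 1 ℕ.+ m ≡ n → m · x ≈ ε → n · x ≈ ε → x ≈ ε
    successive-vanish {m} {x = x} ≡.refl mx≈ε nx≈ε = begin
      x          ≈⟨ identityʳ x ⟨
      x ∙ ε      ≈⟨ ∙-congˡ mx≈ε ⟨
      x ∙ m · x  ≈⟨ nx≈ε ⟩
      ε          ∎

  -- Bézout over the naturals provides multiples of m and n that differ by one. Both kill x, and so
  -- does their difference; no inverses are involved, so a monoid is enough.
  coprime-multiples-vanish : ∀ {m n x} → Coprime m n → m · x ≈ ε → n · x ≈ ε → x ≈ ε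
  coprime-multiples-vanish cop mx≈ε nx≈ε with coprime-Bézout cop
  ... | Bézout.+- k l eq = successive-vanish eq (multiple-vanishes l nx≈ε) (multiple-vanishes k mx≈ε)
  ... | Bézout.-+ k l eq = successive-vanish eq (multiple-vanishes k mx≈ε) (multiple-vanishes l nx≈ε)

-- Translation by x permutes the elements, so Σ a = Σ (a + x) = Σ a + n · x.
module _ {c ℓ} (G : AbelianGroup c ℓ) {n}
         (enumeration : Inverse (AbelianGroup.setoid G) (≡.setoid (Fin n))) where
  open AbelianGroup G hiding (inverseˡ; inverseʳ)
  open AbelianGroupProperties G using (∙-cancelˡ; //-rightDividesˡ; //-rightDividesʳ)
  open Mult monoid using () renaming (_×_ to _·_)
  open Sum commutativeMonoid using (sum; sum-permute; sum-cong-≋; ∑-distrib-+; sum-replicate)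
  open Inverse enumeration
  open SetoidReasoning setoid

  order-annihilates : ∀ x → n · x ≈ ε
  order-annihilates x = ∙-cancelˡ (sum from) _ _ (begin
    sum from ∙ n · x                    ≈⟨ ∙-congˡ (sum-replicate n) ⟨
    sum from ∙ sum (replicate n x)      ≈⟨ ∑-distrib-+ from (replicate n x) ⟨
    sum (λ i → from i ∙ x)              ≈⟨ sum-cong-≋ {n} (λ i → strictlyInverseʳ (from i ∙ x)) ⟨
    sum (λ i → from (to (from i ∙ x)))  ≈⟨ sum-permute from translation ⟨
    sum from                            ≈⟨ identityʳ _ ⟨
    sum from ∙ ε                        ∎)
    where
    translation : Permutation n n
    translation = permutation (λ i → to (from i ∙ x)) (λ i → to (from i ∙ x ⁻¹))
      (λ i → inverseˡ (trans (∙-congʳ (inverseʳ ≡.refl)) (//-rightDividesˡ x (from i))))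
      (λ i → inverseˡ (trans (∙-congʳ (inverseʳ ≡.refl)) (//-rightDividesʳ x (from i))))

-- Cancellation in a finite field.

module _ {c ℓ₁ ℓ₂ q} (F : FiniteField c ℓ₁ ℓ₂ q) where
  open FiniteField F using (heytingField; commutativeRing; enumeration; _≟_)
  open CommutativeRing commutativeRing hiding (_-_) renaming (_+_ to _⊕_; _*_ to _⊛_; -_ to ⊖_)
  open RingProperties ring using (-‿distribˡ-*; x∙y⁻¹≈ε⇒x≈y)
  open SemiringMult semiring using () renaming (_×_ to _·_; ×-comm-* to ·-comm-*; ×-congʳ to ·-congʳ)
  open Codes F
  open SetoidReasoning setoid

  -- If 1 were 0, then 0 would be an inverse of the difference 0 - 0, and 0 would be apart from
  -- itself.
  1≉0 : ¬ 1# ≈ 0#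
  1≉0 1≈0 = HeytingField.#-irrefl heytingField refl (HeytingField.invertible⇒# heytingField {0#} {0#}
    (0# , trans (zeroˡ _) (sym 1≈0) , trans (zeroʳ _) (sym 1≈0)))

  -- Stands in for invertibility: it is all that independence and distance require, and no inverse
  -- has to be constructed.
  Cancellable : Carrier → Set _
  Cancellable x = ∀ a → a ⊛ x ≈ 0# → a ≈ 0#

  -- Since a ⊛ (r · 1) = r · a, both r and q annihilate a in the additive group.
  coprime⇒cancellable : ∀ {r} → Coprime r q → Cancellable (r · 1#)
  coprime⇒cancellable {r} cop a ar≈0 =
    coprime-multiples-vanish +-monoid cop
      (trans (sym (trans (·-comm-* r a 1#) (·-congʳ r (*-identityʳ a)))) ar≈0)
      (order-annihilates +-abelianGroup enumeration a)

  cancel : ∀ {x} → Cancellable x → ∀ a b → a ⊛ x ≈ b ⊛ x → a ≈ b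
  cancel {x} x-canc a b ax≈bx = x∙y⁻¹≈ε⇒x≈y a b (x-canc (a ⊕ ⊖ b) (begin
    (a ⊕ ⊖ b) ⊛ x          ≈⟨ distribʳ x a (⊖ b) ⟩
    a ⊛ x ⊕ (⊖ b) ⊛ x      ≈⟨ +-cong ax≈bx (sym (-‿distribˡ-* b x)) ⟩
    b ⊛ x ⊕ ⊖ (b ⊛ x)      ≈⟨ -‿inverseʳ _ ⟩
    0#                     ∎))

  -- Codes spanned by a single row.

  multiples : ∀ {n} → Word n → LinearCode n
  multiples v = record
    { codewords = λ x → ∃ λ a → ∀ j → a ⊛ v j ≈ x j
    ; resp-≋    = λ x≋y (a , av≋x) → a , λ j → trans (av≋x j) (x≋y j)
    ; 0-closed  = 0# , λ j → zeroˡ _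
    ; +-closed  = λ (a , av≋x) (b , bv≋y) →
        a ⊕ b , λ j → trans (distribʳ _ a b) (+-cong (av≋x j) (bv≋y j))
    ; *-closed  = λ c (a , av≋x) →
        c ⊛ a , λ j → trans (*-assoc c a _) (*-congˡ (av≋x j))
    }

  module _ {m} (v : Word (suc m)) (v-canc : ∀ j → Cancellable (v j)) where

    private
      n = suc m
      C = multiples v

      v∈C : codewords C v
      v∈C = 1# , λ j → *-identityˡ _

    multiples-isBasis : IsBasis C (v ∷ [])
    multiples-isBasis = record
      { members     = λ { Fin.zero → v∈C }
      -- A sum over one row still carries a trailing zero, removed by `+-identityʳ`; the first
      -- coordinate alone determines the scalar.
      ; independent = λ { a av≋0 Fin.zero →
          v-canc Fin.zero _ (trans (sym (+-identityʳ _)) (av≋0 Fin.zero)) }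
      ; spanning    = λ (a , av≋x) → a ∷ [] , λ j → trans (+-identityʳ _) (av≋x j)
      }

    -- Agreement in one coordinate equates the two scalars, by cancelling that entry of v, and hence
    -- the whole words. So no index is filtered out.
    distinct⇒distance≡n : ∀ {x y} → codewords C x → codewords C y →
      ¬ (∀ j → x j ≈ y j) → hammingDistance x y ≡ n
    distinct⇒distance≡n {x} {y} (a , av≋x) (b , bv≋y) x≉y = ≡.trans
      (≡.cong length (filter-all (λ i → ¬? (x i ≟ y i)) (universal differ (allFin n))))
      (length-tabulate {n = n} (λ i → i))
      where
      differ : ∀ j → ¬ x j ≈ y j
      differ j xj≈yj = x≉y λ i → trans (sym (av≋x i)) (trans (*-congʳ a≈b) (bv≋y i))
        where
        a≈b = cancel (v-canc j) a b (trans (av≋x j) (trans xj≈yj (sym (bv≋y j))))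

    multiples-isMDS : Is[ n , 1 , n ]MDSCode C
    multiples-isMDS = record
      { isCode = record
        { dimension       = v ∷ [] , multiples-isBasis
        ; minimumDistance = record
          { attained = v , replicate n 0# , v∈C , 0-closed C , v≉0 ,
                       distinct⇒distance≡n v∈C (0-closed C) v≉0
          ; minimal  = λ x∈C y∈C x≉y → ℕ.≤-reflexive (≡.sym (distinct⇒distance≡n x∈C y∈C x≉y))
          }
        }
      ; mds = ℕ.+-comm n 1
      }
      where
      -- Cancelling the first entry in 1 ⊛ v₀ = 0 would give 1 = 0.
      v≉0 : ¬ (∀ j → v j ≈ 0#)
      v≉0 v≈0 = 1≉0 (v-canc Fin.zero 1# (trans (*-identityˡ _) (v≈0 Fin.zero)))

-- The row with entries (L ± 3M)/2.

mainTheorem1 : ∀ {c ℓ₁ ℓ₂ : Level} (p α : ℕ) (p-prime : Prime p) → p ℕ.% 3 ≡ 1 → 1 ℕ.≤ α →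
    (F : FiniteField c ℓ₁ ℓ₂ (p ℕ.^ α)) → let open Codes F in
    (L M : ℤ) →
    + 4 * + (p ℕ.^ α) ≡ L ^ 2 + + 27 * M ^ 2 →
    L %ℕ 3 ≡ 1 →
    ¬ (+ p ∣ L) →
    ∃ λ (C : LinearCode 2) →
    Is[ 2 , 1 , 2 ]MDSCode C ×
    IsGeneratorMatrix
    ((reduceMod p-prime ((L + + 3 * M) / + 2) ∷ reduceMod p-prime ((L - + 3 * M) / + 2) ∷ []) ∷ [])
    C
-- Writing α as `suc β`, as `1 ≤ α` permits, exposes the factor p of q = p ^ α.
mainTheorem1 p α@(suc β) p-prime _ _ F L M 4q≡L²+27M² _ p∤L =
  multiples F row , multiples-isMDS F row row-cancellable , multiples-isBasis F row row-cancellable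
  where
  row = reduceMod p-prime ((L + + 3 * M) / + 2) ∷ reduceMod p-prime ((L - + 3 * M) / + 2) ∷ []
    where open Codes F

  -- For S = L ± 3M one has 27M² = 3(S - L)²; expanded, this is the premise, which turns the
  -- equation for 4q into the form that `prime∤half` takes.
  half-cancellable : ∀ S → L * L + + 27 * (M * M) + + 6 * (S * L) ≡ + 4 * (L * L) + + 3 * (S * S) →
    Cancellable F (Codes.reduceMod F p-prime (S / + 2))
  half-cancellable S eq = coprime⇒cancellable F (coprime-^ʳ (prime∤⇒coprime-% p-prime {S / + 2}
    (prime∤half p-prime (+ (p ℕ.^ α)) L S
      (≡.trans (≡.cong (_+ + 6 * (S * L)) (≡.trans 4q≡L²+27M² (squares L M))) eq)
      (ℕ.m∣m*n (p ℕ.^ β)) p∤L)) α)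
    where
    -- The left side is what `L ^ 2 + + 27 * M ^ 2` unfolds to.
    squares : ∀ L M → L * (L * + 1) + + 27 * (M * (M * + 1)) ≡ L * L + + 27 * (M * M)
    squares = solve-∀

  row-cancellable : ∀ j → Cancellable F (row j)
  row-cancellable Fin.zero           = half-cancellable (L + + 3 * M) (plus L M)
    where
    plus : ∀ L M → L * L + + 27 * (M * M) + + 6 * ((L + + 3 * M) * L)
      ≡ + 4 * (L * L) + + 3 * ((L + + 3 * M) * (L + + 3 * M))
    plus = solve-∀
  row-cancellable (Fin.suc Fin.zero) = half-cancellable (L - + 3 * M) (minus L M)
    where
    minus : ∀ L M → L * L + + 27 * (M * M) + + 6 * ((L - + 3 * M) * L)
      ≡ + 4 * (L * L) + + 3 * ((L - + 3 * M) * (L - + 3 * M))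
    minus = solve-∀
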